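{- Let $\mathcal{R}$ be an oriented 4-CTRS and let $\ell \to r$ be an unconditional rule in $\mathcal{R}$ (that is, a rule with empty sequence of conditions) such that $\mathcal{V}(r) \nsubseteq \mathcal{V}(\ell)$ and $r$ is a normal form with respect to the underlying TRS $\mathcal{R}_{\mathsf{u}}$. Then $\mathcal{R}$ is non-confluent.
   Context: Terms are the first-order terms $\mathcal{T}(\mathcal{F},\mathcal{V})$ over a signature $\mathcal{F}$ and a countably infinite set of variables $\mathcal{V}$. For a syntactic object $o$ (a term, a list of terms, a list of pairs of terms, etc.), $\mathcal{V}(o)$ denotes the set of variables occurring in $o$. A conditional term rewrite system (CTRS) $\mathcal{R}$ is a set of conditional rewrite rules $\ell \to r \Leftarrow c$ where $\ell, r$ are terms, $\ell \notin \mathcal{V}$, and $c$ is a (possibly empty) sequence of pairs of terms $s_1 \approx t_1, \ldots, s_k \approx t_k$. A rule with empty $c$ is called unconditional. If $\mathcal{V}(r) \subseteq \mathcal{V}(\ell, c)$ for all rules of $\mathcal{R}$, then $\mathcal{R}$ is a 3-CTRS; otherwise it is a 4-CTRS. All CTRSs are oriented: conditions are interpreted as reachability. For each level $i$ an (unconditional) TRS $\mathcal{R}_i$ is defined by $\mathcal{R}_0 = \varnothing$ and $\mathcal{R}_{i+1} = \{\ell\sigma \to r\sigma \mid (\ell \to r \Leftarrow c) \in \mathcal{R},\ \sigma \text{ a substitution},\ s\sigma \to_{\mathcal{R}_i}^{*} t\sigma \text{ for all } s \approx t \text{ in } c\}$. The rewrite relation of $\mathcal{R}$ is $\to_{\mathcal{R}}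 = \bigcup_{i \geq 0} \to_{\mathcal{R}_i}$, where the rewrite relation of a TRS is as usual (closed under contexts and substitutions; right-hand sides of rules may contain variables not occurring in the left-hand side). The underlying TRS $\mathcal{R}_{\mathsf{u}}$ is obtained from $\mathcal{R}$ by dropping all conditions: $\mathcal{R}_{\mathsf{u}} = \{\ell \to r \mid (\ell \to r \Leftarrow c) \in \mathcal{R}\}$. $\mathcal{R}$ is confluent if whenever $s \to_{\mathcal{R}}^{*} t$ and $s \to_{\mathcal{R}}^{*} u$ there is a term $w$ with $t \to_{\mathcal{R}}^{*} w$ and $u \to_{\mathcal{R}}^{*} w$; it is non-confluent if it is not confluent. -}

module Defs where

open import Data.Empty using (⊥)
open import Data.Fin using (Fin)
open import Data.List using (List; []; _∷_; _++_; concatMap)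
open import Data.List.Relation.Binary.Subset.Propositional using (_⊆_)
open import Data.List.Relation.Unary.All using (All)
open import Data.Nat using (ℕ; zero; suc)
open import Data.Product using (Σ-syntax; ∃-syntax; _×_; _,_)
open import Data.Vec using (Vec; []; _∷_; lookup; _[_]≔_)
open import Relation.Binary.Construct.Closure.ReflexiveTransitive using (Star)
open import Relation.Binary.Core using (Rel)
open import Relation.Binary.PropositionalEquality using (_≡_; _≢_)
open import Relation.Nullary using (¬_)
open import Relation.Unary using (Pred; _∈_)
open import Level using (0ℓ)

record Signature : Set₁ where
  field
    Symbol : Set
    arity  : Symbol → ℕ

open Signature public

data Term (𝓕 : Signature) (V : Set) : Set where
  var : V → Term 𝓕 V
  con : (f : Symbol 𝓕) → Vec (Term 𝓕 V) (arity 𝓕 f) → Term 𝓕 V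

module _ {𝓕 : Signature} {V : Set} where

  -- The finite set 𝓥(t), as a list considered up to membership.
  mutual
    vars : Term 𝓕 V → List V
    vars (var x)    = x ∷ []
    vars (con f ts) = varsVec ts

    varsVec : ∀ {n} → Vec (Term 𝓕 V) n → List V
    varsVec []       = []
    varsVec (t ∷ ts) = vars t ++ varsVec ts

Substitution : Signature → Set → Set
Substitution 𝓕 V = V → Term 𝓕 V

module _ {𝓕 : Signature} {V : Set} where

  infixl 30 _⟨_⟩

  mutual
    _⟨_⟩ : Term 𝓕 V → Substitution 𝓕 V → Term 𝓕 V
    var x    ⟨ σ ⟩ = σ x
    con f ts ⟨ σ ⟩ = con f (substVec ts σ)

    substVec : ∀ {n} → Vec (Term 𝓕 V) n → Substitution 𝓕 V → Vec (Term 𝓕 V) n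
    substVec []       σ = []
    substVec (t ∷ ts) σ = t ⟨ σ ⟩ ∷ substVec ts σ

TRS : Signature → Set → Set₁
TRS 𝓕 V = Pred (Term 𝓕 V × Term 𝓕 V) 0ℓ

module _ {𝓕 : Signature} {V : Set} where

  -- Closure under contexts is expressed one symbol at a time.  In `root` the
  -- substitution also instantiates variables occurring only in r.
  data Step (𝓢 : TRS 𝓕 V) : Rel (Term 𝓕 V) 0ℓ where
    root : ∀ {l r} → (l , r) ∈ 𝓢 → (σ : Substitution 𝓕 V) →
           Step 𝓢 (l ⟨ σ ⟩) (r ⟨ σ ⟩)
    arg  : ∀ {f} (ts : Vec (Term 𝓕 V) (arity 𝓕 f)) (i : Fin (arity 𝓕 f)) {u} →
           Step 𝓢 (lookup ts i) u →
           Step 𝓢 (con f ts) (con f (ts [ i ]≔ u))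

Conditions : Signature → Set → Set
Conditions 𝓕 V = List (Term 𝓕 V × Term 𝓕 V)

infix 4 _⟶_⇐_

record Rule (𝓕 : Signature) (V : Set) : Set where
  constructor _⟶_⇐_
  field
    lhs   : Term 𝓕 V
    rhs   : Term 𝓕 V
    conds : Conditions 𝓕 V

record CTRS (𝓕 : Signature) (V : Set) : Set₁ where
  field
    rules      : Pred (Rule 𝓕 V) 0ℓ
    lhs-nonvar : ∀ {l r c} → (l ⟶ r ⇐ c) ∈ rules → ∀ x → l ≢ var x

open CTRS public

module _ {𝓕 : Signature} {V : Set} where

  varsConds : Conditions 𝓕 V → List V
  varsConds = concatMap λ (s , t) → vars s ++ vars t

  Is3CTRS : CTRS 𝓕 V → Set
  Is3CTRS 𝓡 = ∀ {l r c} → (l ⟶ r ⇐ c) ∈ rules 𝓡 →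
              vars r ⊆ vars l ++ varsConds c

  Is4CTRS : CTRS 𝓕 V → Set
  Is4CTRS 𝓡 = ¬ Is3CTRS 𝓡

  underlying : CTRS 𝓕 V → TRS 𝓕 V
  underlying 𝓡 (l , r) = ∃[ c ] (l ⟶ r ⇐ c) ∈ rules 𝓡

  level : CTRS 𝓕 V → ℕ → TRS 𝓕 V
  level 𝓡 zero    _         = ⊥
  level 𝓡 (suc i) (l′ , r′) =
    ∃[ l ] ∃[ r ] ∃[ c ] Σ[ σ ∈ Substitution 𝓕 V ]
      (l ⟶ r ⇐ c) ∈ rules 𝓡
      × All (λ (s , t) → Star (Step (level 𝓡 i)) (s ⟨ σ ⟩) (t ⟨ σ ⟩)) c
      × l′ ≡ l ⟨ σ ⟩
      × r′ ≡ r ⟨ σ ⟩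

  Rewrites : CTRS 𝓕 V → Rel (Term 𝓕 V) 0ℓ
  Rewrites 𝓡 s t = ∃[ i ] Step (level 𝓡 i) s t

{-# OPTIONS --safe #-}

-- Pick x ∈ 𝓥(r) ∖ 𝓥(l) and a variable y ∉ 𝓥(r), and let τ replace x by y.  Then
-- l = lτ rewrites to both r and rτ.  Replacing y by x turns rτ back into r, so
-- rτ inherits normality from r; r and rτ are distinct normal forms of l.

module Submission where

open import Defs
open import Data.Fin using (zero; suc)
open import Data.List using (List; []; _∷_; map)
open import Data.List.Membership.Propositional using (_∉_) renaming (_∈_ to _∈ˡ_)
open import Data.List.Membership.Propositional.Properties
  using (∈-++⁺ˡ; ∈-++⁺ʳ; ∈-++⁻; ∈-map⁺)
open import Data.List.Relation.Binary.Subset.Propositional using (_⊆_)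
open import Data.List.Relation.Unary.All as All using ([])
open import Data.List.Relation.Unary.Any using (here)
open import Data.Nat using (ℕ; suc; _≤_)
open import Data.Nat.Properties using (≤-totalOrder; 1+n≰n; _≟_)
open import Data.Product using (∃-syntax; _,_)
open import Data.Sum using (inj₁; inj₂)
open import Data.Vec using (Vec; []; _∷_; lookup; _[_]≔_)
open import Data.Vec.Properties using (∷-injectiveˡ; ∷-injectiveʳ)
open import Function using (_∘_)
open import Function.Bundles using (_↔_; module Inverse)
open import Function.Properties.Inverse using (↔⇒↣)
open import Relation.Binary.Construct.Closure.ReflexiveTransitive using (ε; _◅_)
open import Relation.Binary.Construct.Closure.Symmetric using (fwd; bwd)
open import Relation.Binary.Definitions using (DecidableEquality)
open import Relation.Binary.PropositionalEquality
  using (_≡_; _≢_; refl; sym; trans; cong; cong₂; subst; subst₂)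
open import Relation.Binary.Rewriting using (IsNormalForm; Confluent; conf⇒unf)
open import Relation.Nullary using (¬_; yes; no; contradiction)
open import Relation.Nullary.Decidable using (via-injection; decidable-stable)
open import Relation.Unary using (_∈_)
import Data.List.Membership.DecPropositional as DecMembership
open import Data.List.Extrema ≤-totalOrder using (max; xs≤max)

module _ {𝓕 : Signature} {V : Set} where

  mutual
    ⟨⟩-cong : ∀ (t : Term 𝓕 V) {σ τ} → (∀ {x} → x ∈ˡ vars t → σ x ≡ τ x) →
              t ⟨ σ ⟩ ≡ t ⟨ τ ⟩
    ⟨⟩-cong (var x)    σ≗τ = σ≗τ (here refl)
    ⟨⟩-cong (con f ts) σ≗τ = cong (con f) (substVec-cong ts σ≗τ)

    substVec-cong : ∀ {n} (ts : Vec (Term 𝓕 V) n) {σ τ} →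
                    (∀ {x} → x ∈ˡ varsVec ts → σ x ≡ τ x) →
                    substVec ts σ ≡ substVec ts τ
    substVec-cong []       σ≗τ = refl
    substVec-cong (t ∷ ts) σ≗τ =
      cong₂ _∷_ (⟨⟩-cong t (σ≗τ ∘ ∈-++⁺ˡ)) (substVec-cong ts (σ≗τ ∘ ∈-++⁺ʳ (vars t)))

  con-injective : ∀ {f} {ts us : Vec (Term 𝓕 V) (arity 𝓕 f)} → con f ts ≡ con f us → ts ≡ us
  con-injective refl = refl

  mutual
    -- Equal instances of one term agree at each position where a variable stands. Comparing `r`
    -- with its renamed copy this way recovers the value of the renaming at `x`.
    ⟨⟩-injective : ∀ (t : Term 𝓕 V) {σ τ} → t ⟨ σ ⟩ ≡ t ⟨ τ ⟩ →
                   ∀ {x} → x ∈ˡ vars t → σ x ≡ τ x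
    ⟨⟩-injective (var x)    eq (here refl) = eq
    ⟨⟩-injective (con f ts) eq x∈ts = substVec-injective ts (con-injective eq) x∈ts

    substVec-injective : ∀ {n} (ts : Vec (Term 𝓕 V) n) {σ τ} → substVec ts σ ≡ substVec ts τ →
                         ∀ {x} → x ∈ˡ varsVec ts → σ x ≡ τ x
    substVec-injective (t ∷ ts) eq x∈ts with ∈-++⁻ (vars t) x∈ts
    ... | inj₁ x∈t  = ⟨⟩-injective t (∷-injectiveˡ eq) x∈t
    ... | inj₂ x∈ts = substVec-injective ts (∷-injectiveʳ eq) x∈ts

  mutual
    ⟨⟩-var : ∀ (t : Term 𝓕 V) → t ⟨ var ⟩ ≡ t
    ⟨⟩-var (var x)    = refl
    ⟨⟩-var (con f ts) = cong (con f) (substVec-var ts)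

    substVec-var : ∀ {n} (ts : Vec (Term 𝓕 V) n) → substVec ts var ≡ ts
    substVec-var []       = refl
    substVec-var (t ∷ ts) = cong₂ _∷_ (⟨⟩-var t) (substVec-var ts)

  ⟨⟩-id : ∀ (t : Term 𝓕 V) {σ} → (∀ {x} → x ∈ˡ vars t → σ x ≡ var x) → t ⟨ σ ⟩ ≡ t
  ⟨⟩-id t σ≗var = trans (⟨⟩-cong t σ≗var) (⟨⟩-var t)

  mutual
    ⟨⟩-∘ : ∀ (t : Term 𝓕 V) σ τ → t ⟨ σ ⟩ ⟨ τ ⟩ ≡ t ⟨ (λ x → σ x ⟨ τ ⟩) ⟩
    ⟨⟩-∘ (var x)    σ τ = refl
    ⟨⟩-∘ (con f ts) σ τ = cong (con f) (substVec-∘ ts σ τ)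

    substVec-∘ : ∀ {n} (ts : Vec (Term 𝓕 V) n) σ τ →
                 substVec (substVec ts σ) τ ≡ substVec ts (λ x → σ x ⟨ τ ⟩)
    substVec-∘ []       σ τ = refl
    substVec-∘ (t ∷ ts) σ τ = cong₂ _∷_ (⟨⟩-∘ t σ τ) (substVec-∘ ts σ τ)

  lookup-substVec : ∀ {n} (ts : Vec (Term 𝓕 V) n) i σ →
                    lookup (substVec ts σ) i ≡ lookup ts i ⟨ σ ⟩
  lookup-substVec (t ∷ ts) zero    σ = refl
  lookup-substVec (t ∷ ts) (suc i) σ = lookup-substVec ts i σ

  substVec-[]≔ : ∀ {n} (ts : Vec (Term 𝓕 V) n) i u σ →
                 substVec (ts [ i ]≔ u) σ ≡ substVec ts σ [ i ]≔ u ⟨ σ ⟩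
  substVec-[]≔ (t ∷ ts) zero    u σ = refl
  substVec-[]≔ (t ∷ ts) (suc i) u σ = cong (t ⟨ σ ⟩ ∷_) (substVec-[]≔ ts i u σ)

  -- `root` applies a single substitution, so two successive ones are composed first. Such nesting
  -- arises when a step is instantiated, and also at a level, whose rules are themselves instances.
  Step-instance : ∀ {𝓢 : TRS 𝓕 V} {l r} → (l , r) ∈ 𝓢 → ∀ σ τ →
                  Step 𝓢 (l ⟨ σ ⟩ ⟨ τ ⟩) (r ⟨ σ ⟩ ⟨ τ ⟩)
  Step-instance {𝓢} {l} {r} lr∈𝓢 σ τ =
    subst₂ (Step 𝓢) (sym (⟨⟩-∘ l σ τ)) (sym (⟨⟩-∘ r σ τ)) (root lr∈𝓢 _)

  Step-⟨⟩ : ∀ {𝓢 : TRS 𝓕 V} {s t} σ → Step 𝓢 s t → Step 𝓢 (s ⟨ σ ⟩) (t ⟨ σ ⟩)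
  Step-⟨⟩ τ (root lr∈𝓢 σ) = Step-instance lr∈𝓢 σ τ
  Step-⟨⟩ {𝓢} σ (arg {f} ts i {u} step) =
    subst (λ us → Step 𝓢 (con f (substVec ts σ)) (con f us)) (sym (substVec-[]≔ ts i u σ))
      (arg (substVec ts σ) i
        (subst (λ t → Step 𝓢 t (u ⟨ σ ⟩)) (sym (lookup-substVec ts i σ)) (Step-⟨⟩ σ step)))

  -- Any step from `t` would survive instantiation by `σ`.
  IsNormalForm-⟨⟩⁻ : ∀ {𝓢 : TRS 𝓕 V} t σ →
                     IsNormalForm (Step 𝓢) (t ⟨ σ ⟩) → IsNormalForm (Step 𝓢) t
  IsNormalForm-⟨⟩⁻ t σ nf (_ , step) = nf (_ , Step-⟨⟩ σ step)

  -- The conditions are simply discarded, so lower levels are never inspected and the recursion is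
  -- on the step alone. Level 0 has no rules, hence no root step.
  level-step⇒underlying-step : ∀ (𝓡 : CTRS 𝓕 V) i {s t} →
                               Step (level 𝓡 i) s t → Step (underlying 𝓡) s t
  level-step⇒underlying-step 𝓡 (suc i) (root (_ , _ , c , σ , rule∈𝓡 , _ , refl , refl) τ) =
    Step-instance (c , rule∈𝓡) σ τ
  level-step⇒underlying-step 𝓡 i (arg ts j step) =
    arg ts j (level-step⇒underlying-step 𝓡 i step)

  underlying-nf⇒nf : ∀ (𝓡 : CTRS 𝓕 V) {t} →
                     IsNormalForm (Step (underlying 𝓡)) t → IsNormalForm (Rewrites 𝓡) t
  underlying-nf⇒nf 𝓡 nf (_ , i , step) = nf (_ , level-step⇒underlying-step 𝓡 i step)

  unconditional-step : ∀ (𝓡 : CTRS 𝓕 V) {l r} → (l ⟶ r ⇐ []) ∈ rules 𝓡 →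
                       ∀ σ → Rewrites 𝓡 (l ⟨ σ ⟩) (r ⟨ σ ⟩)
  unconditional-step 𝓡 {l} {r} rule∈𝓡 σ =
    -- Level 1 suffices, since an empty list of conditions holds vacuously over level 0. The level
    -- rule already carries `σ`, so `root` adds only the identity.
    1 , subst₂ (Step (level 𝓡 1)) (⟨⟩-var (l ⟨ σ ⟩)) (⟨⟩-var (r ⟨ σ ⟩))
          (root (l , r , [] , σ , rule∈𝓡 , [] , refl , refl) var)

module _ {V : Set} (V↔ℕ : V ↔ ℕ) where
  open Inverse V↔ℕ

  fresh : ∀ (xs : List V) → ∃[ y ] y ∉ xs
  fresh xs = from (suc m) , λ y∈xs →
    1+n≰n (subst (_≤ m) (strictlyInverseˡ (suc m))
      (All.lookup (xs≤max 0 (map to xs)) (∈-map⁺ to y∈xs)))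
    where m = max 0 (map to xs)

module _ {V : Set} (_≟_ : DecidableEquality V) where

  replace : V → V → V → V
  replace x y z with z ≟ x
  ... | yes _ = y
  ... | no  _ = z

  replace-≡ : ∀ x y → replace x y x ≡ y
  replace-≡ x y with x ≟ x
  ... | yes _   = refl
  ... | no  x≢x = contradiction refl x≢x

  replace-≢ : ∀ {x z} y → z ≢ x → replace x y z ≡ z
  replace-≢ {x} {z} y z≢x with z ≟ x
  ... | yes z≡x = contradiction z≡x z≢x
  ... | no  _   = refl

  -- `x` travels to `y` and back, and other variables stay put; `y` is excluded because it would end
  -- at `x`.
  replace-inverse : ∀ {x y z} → z ≢ y → replace y x (replace x y z) ≡ z
  replace-inverse {x} {y} {z} z≢y with z ≟ x
  ... | yes refl = replace-≡ y x
  ... | no  _    = replace-≢ x z≢y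

lemma1 : (𝓕 : Signature) (V : Set) → V ↔ ℕ →
    (𝓡 : CTRS 𝓕 V) → Is4CTRS 𝓡 →
    (l r : Term 𝓕 V) → (l ⟶ r ⇐ []) ∈ rules 𝓡 →
    ¬ (vars r ⊆ vars l) →
    IsNormalForm (Step (underlying 𝓡)) r →
    ¬ Confluent (Rewrites 𝓡)
lemma1 𝓕 V V↔ℕ 𝓡 _ l r rule∈𝓡 r⊈l r-nf confluent =
  -- A negated inclusion yields no witness `x` directly. Instead the inclusion is proved,
  -- decidability of membership removing the double negation.
  r⊈l λ {x} x∈r → decidable-stable (x ∈? vars l) (no-extra-variable x∈r)
  where
  _≟ⱽ_ : DecidableEquality V
  _≟ⱽ_ = via-injection (↔⇒↣ V↔ℕ) _≟_

  open DecMembership _≟ⱽ_ using (_∈?_)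

  no-extra-variable : ∀ {x} → x ∈ˡ vars r → ¬ (x ∉ vars l)
  no-extra-variable {x} x∈r x∉l with fresh V↔ℕ (vars r)
  ... | y , y∉r = y∉r (subst (_∈ˡ vars r) x≡y x∈r)
    where
    τ ρ : Substitution 𝓕 V
    τ = var ∘ replace _≟ⱽ_ x y
    ρ = var ∘ replace _≟ⱽ_ y x

    lτ≡l : l ⟨ τ ⟩ ≡ l
    lτ≡l = ⟨⟩-id l λ z∈l →
      cong var (replace-≢ _≟ⱽ_ y λ { refl → x∉l z∈l })

    rτρ≡r : r ⟨ τ ⟩ ⟨ ρ ⟩ ≡ r
    rτρ≡r = trans (⟨⟩-∘ r τ ρ) (⟨⟩-id r λ z∈r →
      cong var (replace-inverse _≟ⱽ_ λ { refl → y∉r z∈r }))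

    rτ-nf : IsNormalForm (Step (underlying 𝓡)) (r ⟨ τ ⟩)
    rτ-nf = IsNormalForm-⟨⟩⁻ (r ⟨ τ ⟩) ρ
      (subst (IsNormalForm (Step (underlying 𝓡))) (sym rτρ≡r) r-nf)

    l⟶r : Rewrites 𝓡 l r
    l⟶r = subst₂ (Rewrites 𝓡) (⟨⟩-var l) (⟨⟩-var r) (unconditional-step 𝓡 rule∈𝓡 var)

    l⟶rτ : Rewrites 𝓡 l (r ⟨ τ ⟩)
    l⟶rτ = subst (λ t → Rewrites 𝓡 t (r ⟨ τ ⟩)) lτ≡l (unconditional-step 𝓡 rule∈𝓡 τ)

    r≡rτ : r ≡ r ⟨ τ ⟩
    -- The peak from `l` is a conversion between two normal forms, which confluence forces to
    -- coincide.
    r≡rτ = conf⇒unf confluent (underlying-nf⇒nf 𝓡 r-nf) (underlying-nf⇒nf 𝓡 rτ-nf)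
      (bwd l⟶r ◅ fwd l⟶rτ ◅ ε)

    var-injective : ∀ {u v} → var {𝓕} {V} u ≡ var v → u ≡ v
    var-injective refl = refl

    x≡y : x ≡ y
    -- Read at `x`, the equality of the instances of `r` under `var` and `τ` says that `var x` is
    -- `τ x`, which is `var y`.
    x≡y = var-injective (trans
      (⟨⟩-injective r (trans (⟨⟩-var r) r≡rτ) x∈r)
      (cong var (replace-≡ _≟ⱽ_ x y)))
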